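{- For every parallel pushdown automaton $M$ there is a finite weakly guarded recursive specification $\Gamma$ over $\mathrm{BCP}^{\mathbf{0}\mathbf{1}}_{\theta}$ (with a designated initial identifier) such that the process graph of $\Gamma$ and the process graph $\mathcal{P}(M)$ of $M$ are divergence-preserving branching bisimilar.
   Context: **Labelled transition systems and process graphs.** A labelled transition system is a tuple $(\mathcal{S},\mathcal{A},\rightarrow,\downarrow)$ with $\mathcal{S}$ a set of states, $\mathcal{A}$ a set of actions, $\tau\notin\mathcal{A}$ the silent action, $\rightarrow\,\subseteq\mathcal{S}\times(\mathcal{A}\cup\{\tau\})\times\mathcal{S}$ the transition relation, and $\downarrow\,\subseteq\mathcal{S}$ the set of accepting (final) states; write $s\xrightarrow{a}s'$ and $s\downarrow$. A process graph is a labelled transition system with a designated root state. Write $s\Rightarrow t$ if $t$ can be reached from $s$ by zero or more $\tau$-transitions, $s\Rightarrow^{+}t$ if by one or more, and $s\xrightarrow{(a)}t$ if $s\xrightarrow{a}t$, or $a=\tau$ and $s=t$. **Divergence-preserving branching bisimilarity.** A symmetric relation $R$ on $\mathcal{S}$ is a branching bisimulation if for all $s\mathrel{R}t$ and $a\in\mathcal{A}\cup\{\tau\}$: (1) if $s\xrightarrow{a}s'$ then there are $t'',t'$ with $t\Rightarrow t''\xrightarrow{(a)}t'$, $s\mathrel{R}t''$ and $s'\mathrel{R}t'$; (2) if $s\downarrow$ then there is $t'$ with $t\Rightarrow t'$ and $t'\downarrow$. It is divergence-preserving if for all $s,t$, whenever there is an infinite sequence $s=s_0\xrightarrow{\tau}s_1\xrightarrow{\tau}s_2\cdots$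 with $s_i\mathrel{R}t$ for all $i\geq 0$, there is $t'$ with $t\Rightarrow^{+}t'$ and $s_i\mathrel{R}t'$ for some $i\geq 0$. States $s,t$ are divergence-preserving branching bisimilar if some divergence-preserving branching bisimulation relates them. Two process graphs are divergence-preserving branching bisimilar if their roots are, in the disjoint union of the two underlying labelled transition systems (over the union of their action sets). **Parallel pushdown automata.** $\mathcal{D}^{\{\!\{\,\}\!\}}$ is the set of finite multisets (bags) over $\mathcal{D}$, $\cup$ on bags is multiset sum, and $\mathcal{D}^{\pm}=\{+d\mid d\in\mathcal{D}\}\cup\{ -d\mid d\in\mathcal{D}\}$ (two disjoint copies of $\mathcal{D}$). A parallel pushdown automaton is a tuple $M=(\mathcal{S},\mathcal{A},\mathcal{D},\rightarrow,\uparrow,\downarrow)$ with $\mathcal{S}$ a finite set of states, $\mathcal{A}$ a finite input alphabet ($\tau\notin\mathcal{A}$), $\mathcal{D}$ a finite data alphabet, $\rightarrow\,\subseteq\mathcal{S}\times(\mathcal{A}\cup\{\tau\})\times\mathcal{D}^{\pm}\times\mathcal{D}^{\{\!\{\,\}\!\}}\times\mathcal{S}$ a finite set of transitions, $\uparrow\,\in\mathcal{S}$ the initial state, and $\downarrow\,\subseteq\mathcal{S}$ the accepting states. Write $s\xrightarrow{a[+d/x]}t$ for $(s,a,+d,x,t)\in\,\rightarrow$, and $s\xrightarrow{a[-d/x]}t$ for $(s,a,-d,x,t)\in\,\rightarrow$. The process graph $\mathcal{P}(M)$ has states $(s,x)$ with $s\in\mathcal{S}$, $x\in\mathcal{D}^{\{\!\{\,\}\!\}}$;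 root $(\uparrow,\emptyset)$; accepting states all $(s,x)$ with $s\in\,\downarrow$; and exactly the transitions $(s,\{\!\{d\}\!\}\cup x)\xrightarrow{a}(s',x'\cup x)$ whenever $s\xrightarrow{a[+d/x']}s'$, and $(s,x)\xrightarrow{a}(s',x'\cup x)$ whenever there is $d\notin x$ with $s\xrightarrow{a[-d/x']}s'$. **Process algebra $\mathrm{BCP}^{\mathbf{0}\mathbf{1}}_{\theta}$.** Let $\mathcal{A}$ be a set of actions, $\tau\notin\mathcal{A}$ the silent action, and $\mathcal{P}$ a finite set of process identifiers. Let $\mathcal{C}$ be a finite set of communication ports and $\mathcal{V}$ a finite data set of values; for $c\in\mathcal{C}$, $v\in\mathcal{V}$ the set $\mathcal{A}$ contains the send action $c!v$, the receive action $c?v$ and the communication action $c(v)$. For $C\subseteq\mathcal{C}$ let $\mathit{COM}_C=\{c!v,c?v\mid c\in C,v\in\mathcal{V}\}$. Let $<$ be a (strict) partial ordering on $\mathcal{A}\cup\{\tau\}$ (the priority ordering; $a<b$ means $a$ has lower priority than $b$) such that $\tau<a$ never holds, and whenever $a<b$ then also $a<\tau$ for $a\in\mathcal A$, $b\in\mathcal A\cup\{\tau\}$. The sets $\mathcal{A}$ (which may contain auxiliary actions), $\mathcal{C}$, $\mathcal{V}$ and the ordering $<$ are parameters of the algebra, and giving a specification includes choosing them. Process expressions are generated by $p::=\mathbf{0}\mid\mathbf{1}\mid a.p\mid p+p\mid p\parallel p\mid X\mid\theta(p)\mid\rho_f(p)\mid\partial_C(p)\mid\tau_C(p)$ with $a\in\mathcal{A}\cup\{\tau\}$,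 $X\in\mathcal{P}$, $C\subseteq\mathcal{C}$, and $f$ any function on $\mathcal{A}\cup\{\tau\}$ with $f(\tau)=\tau$ (priority, renaming, encapsulation and abstraction operators). A (finite) recursive specification $\Gamma$ assigns to every $X\in\mathcal{P}$ exactly one defining equation $X\stackrel{\mathrm{def}}{=}p$ with $p$ a process expression. It is weakly guarded if every occurrence of a process identifier in the right-hand side of a defining equation is within the scope of an action prefix $a.\_$ with $a\in\mathcal{A}\cup\{\tau\}$. Transitions and acceptance of process expressions relative to $\Gamma$ are determined by: $\mathbf{1}\downarrow$; $a.p\xrightarrow{a}p$; if $p\downarrow$ or $q\downarrow$ then $(p+q)\downarrow$; if $p\xrightarrow{a}p'$ then $p+q\xrightarrow{a}p'$ and $q+p\xrightarrow{a}p'$; if $p\downarrow$ and $q\downarrow$ then $(p\parallel q)\downarrow$; if $p\xrightarrow{a}p'$ then $p\parallel q\xrightarrow{a}p'\parallel q$ and $q\parallel p\xrightarrow{a}q\parallel p'$; if $p\xrightarrow{c!v}p'$ and $q\xrightarrow{c?v}q'$ then $p\parallel q\xrightarrow{c(v)}p'\parallel q'$ and $q\parallel p\xrightarrow{c(v)}q'\parallel p'$; if $X\stackrel{\mathrm{def}}{=}p$ and $p\xrightarrow{a}p'$ then $X\xrightarrow{a}p'$; if $X\stackrel{\mathrm{def}}{=}p$ and $p\downarrow$ then $X\downarrow$; if $p\downarrow$ then $\theta(p)\downarrow$, $\rho_f(p)\downarrow$, $\partial_C(p)\downarrow$ and $\tau_C(p)\downarrow$; if $p\xrightarrow{a}p'$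 and for all $b>a$ there is no $p''$ with $p\xrightarrow{b}p''$, then $\theta(p)\xrightarrow{a}\theta(p')$; if $p\xrightarrow{a}p'$ then $\rho_f(p)\xrightarrow{f(a)}\rho_f(p')$; if $p\xrightarrow{a}p'$ and $a\notin\mathit{COM}_C$ then $\partial_C(p)\xrightarrow{a}\partial_C(p')$; if $p\xrightarrow{c(v)}p'$ with $c\in C$ then $\tau_C(p)\xrightarrow{\tau}\tau_C(p')$; if $p\xrightarrow{a}p'$ and $a$ is not of the form $c(v)$ with $c\in C$ then $\tau_C(p)\xrightarrow{a}\tau_C(p')$. (For weakly guarded specifications the rules, including the one with a negative premise, determine a unique transition relation.) The process graph of $\Gamma$ is this labelled transition system with the initial identifier as root. -}

module Defs where

open import Level using (0ℓ)
open import Data.Empty using (⊥)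
open import Data.Fin.Base using (Fin)
open import Data.Fin.Subset using (Subset; _∈_)
open import Data.List.Base using (List)
open import Data.List.Membership.Propositional using () renaming (_∈_ to _∈ₗ_)
open import Data.Maybe.Base using (Maybe; just; nothing; map)
open import Data.Nat.Base using (ℕ; zero; suc; _≤_; _<_; _⊔_; z≤n; s≤s)
open import Data.Nat.Properties using (≤-refl; ≤-trans; m≤m⊔n; m≤n⊔m; ≤-reflexive; n≤1+n)
open import Data.Product.Base using (Σ; ∃-syntax; _×_; _,_)
open import Data.Sum.Base using (_⊎_; inj₁; inj₂)
open import Data.Vec.Base using (Vec; lookup; replicate; zipWith; _[_]≔_)
open import Function.Bundles using (_⇔_; mk⇔; module Equivalence)
open import Relation.Binary.Core using (Rel)
open import Relation.Binary.Definitions using (Symmetric)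
open import Relation.Binary.Structures using (IsStrictPartialOrder)
open import Relation.Binary.Construct.Closure.ReflexiveTransitive using (Star)
open import Relation.Binary.Construct.Closure.Transitive using (TransClosure)
open import Relation.Binary.PropositionalEquality.Core using (_≡_; refl; cong; cong₂)
open import Relation.Nullary.Negation.Core using (¬_)

-- A label over A is an element of A ∪ {τ}.
Label : Set → Set
Label A = Maybe A

pattern τ = nothing

record LTS (A : Set) : Set₁ where
  field
    State     : Set
    _—[_]→_   : State → Label A → State → Set
    Accepting : State → Set

  _⇒_ : Rel State 0ℓ
  _⇒_ = Star (λ s t → s —[ τ ]→ t)

  _⇒⁺_ : Rel State 0ℓ
  _⇒⁺_ = TransClosure (λ s t → s —[ τ ]→ t)

  _—⟨_⟩→_ : State → Label A → State → Set
  s —⟨ a ⟩→ t = s —[ a ]→ t ⊎ (a ≡ τ × s ≡ t)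

record ProcessGraph (A : Set) : Set₁ where
  field
    lts  : LTS A
    root : LTS.State lts

module _ {A : Set} (L : LTS A) where
  open LTS L

  record IsBranchingBisimulation (R : Rel State 0ℓ) : Set where
    field
      symmetric  : Symmetric R
      transition : ∀ {s t} → R s t → ∀ {a s′} → s —[ a ]→ s′ →
                   ∃[ t″ ] ∃[ t′ ] t ⇒ t″ × t″ —⟨ a ⟩→ t′ × R s t″ × R s′ t′
      acceptance : ∀ {s t} → R s t → Accepting s →
                   ∃[ t′ ] t ⇒ t′ × Accepting t′

  DivergencePreserving : Rel State 0ℓ → Set
  DivergencePreserving R =
    ∀ (σ : ℕ → State) t →
    (∀ i → σ i —[ τ ]→ σ (suc i)) → (∀ i → R (σ i) t) →
    ∃[ t′ ] t ⇒⁺ t′ × ∃[ i ] R (σ i) t′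

  StatesBisimilar : State → State → Set₁
  StatesBisimilar s t =
    Σ (Rel State 0ℓ) λ R →
      IsBranchingBisimulation R × DivergencePreserving R × R s t

module _ {A : Set} (L₁ L₂ : LTS A) where
  private
    module L₁ = LTS L₁
    module L₂ = LTS L₂

  data UnionStep : L₁.State ⊎ L₂.State → Label A → L₁.State ⊎ L₂.State → Set where
    left  : ∀ {s a t} → s L₁.—[ a ]→ t → UnionStep (inj₁ s) a (inj₁ t)
    right : ∀ {s a t} → s L₂.—[ a ]→ t → UnionStep (inj₂ s) a (inj₂ t)

  data UnionAccepting : L₁.State ⊎ L₂.State → Set where
    left  : ∀ {s} → L₁.Accepting s → UnionAccepting (inj₁ s)
    right : ∀ {s} → L₂.Accepting s → UnionAccepting (inj₂ s)

  disjointUnion : LTS A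
  disjointUnion = record
    { State     = L₁.State ⊎ L₂.State
    ; _—[_]→_   = UnionStep
    ; Accepting = UnionAccepting
    }

DPBranchingBisimilar : {A : Set} → ProcessGraph A → ProcessGraph A → Set₁
DPBranchingBisimilar G H =
  StatesBisimilar (disjointUnion G.lts H.lts) (inj₁ G.root) (inj₂ H.root)
  where
  module G = ProcessGraph G
  module H = ProcessGraph H

-- The same graph over a larger action set.  The relabelling is meant to be
-- injective: it plays the role of an inclusion of action sets.
embed : {A B : Set} → (A → B) → ProcessGraph A → ProcessGraph B
embed ι G = record
  { lts = record
    { State     = State
    ; _—[_]→_   = λ s b t → ∃[ a ] b ≡ map ι a × s —[ a ]→ t
    ; Accepting = Accepting
    }
  ; root = root
  }
  where
  open ProcessGraph G
  open LTS lts

-- Finite multisets over Fin d, given by their multiplicities.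
Bag : ℕ → Set
Bag d = Vec ℕ d

module _ {d : ℕ} where
  infixr 6 _∪_

  ∅ : Bag d
  ∅ = replicate d 0

  ⁅_⁆ : Fin d → Bag d
  ⁅ x ⁆ = ∅ [ x ]≔ 1

  _∪_ : Bag d → Bag d → Bag d
  _∪_ = zipWith Data.Nat.Base._+_

  _∉ᵇ_ : Fin d → Bag d → Set
  x ∉ᵇ b = lookup b x ≡ 0

data Signed (D : Set) : Set where
  +[_] -[_] : D → Signed D

record PPDA : Set where
  field
    #states #inputs #data : ℕ

  State : Set
  State = Fin #states

  Input : Set
  Input = Fin #inputs

  Datum : Set
  Datum = Fin #data

  field
    transitions : List (State × Label Input × Signed Datum × Bag #data × State)
    initial     : State
    accepting   : Subset #states

  Config : Set
  Config = State × Bag #data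

  data Step : Config → Label Input → Config → Set where
    remove : ∀ {s a d x′ s′} x → (s , a , +[ d ] , x′ , s′) ∈ₗ transitions →
             Step (s , ⁅ d ⁆ ∪ x) a (s′ , x′ ∪ x)
    absent : ∀ {s a d x′ s′} x → (s , a , -[ d ] , x′ , s′) ∈ₗ transitions →
             d ∉ᵇ x → Step (s , x) a (s′ , x′ ∪ x)

  graph : ProcessGraph Input
  graph = record
    { lts = record
      { State     = Config
      ; _—[_]→_   = Step
      ; Accepting = λ (s , x) → s ∈ accepting
      }
    ; root = initial , ∅
    }

-- Actions over the ports Fin c and the values Fin v; B supplies the actions
-- that are not of the form c!v, c?v or c(v).  These three are written c ! v,
-- c ⁇ v and c ⟨ v ⟩, since ? and parentheses are reserved.
data Action (B : Set) (c v : ℕ) : Set where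
  basic     : B → Action B c v
  _!_ _⁇_   : Fin c → Fin v → Action B c v
  _⟨_⟩      : Fin c → Fin v → Action B c v

record Signature : Set₁ where
  field
    Basic          : Set
    #ports #values : ℕ

  Act : Set
  Act = Action Basic #ports #values

  field
    _≺_                  : Rel (Label Act) 0ℓ
    isStrictPartialOrder : IsStrictPartialOrder _≡_ _≺_
    τ-not-below          : ∀ {a} → ¬ (τ ≺ a)
    below⇒below-τ        : ∀ {a : Act} {b} → just a ≺ b → just a ≺ τ

module BCP (S : Signature) where
  open Signature S

  Ports : Set
  Ports = Subset #ports

  data COM (C : Ports) : Label Act → Set where
    send    : ∀ {c} v → c ∈ C → COM C (just (c ! v))
    receive : ∀ {c} v → c ∈ C → COM C (just (c ⁇ v))

  data Communication (C : Ports) : Label Act → Set where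
    comm : ∀ {c} v → c ∈ C → Communication C (just (c ⟨ v ⟩))

  infixr 8 _·_
  infixl 6 _+_
  infixl 7 _∥_

  data Proc (n : ℕ) : Set where
    𝟎 𝟏     : Proc n
    _·_     : Label Act → Proc n → Proc n
    _+_ _∥_ : Proc n → Proc n → Proc n
    var     : Fin n → Proc n
    θ       : Proc n → Proc n
    ρ       : (f : Label Act → Label Act) → f τ ≡ τ → Proc n → Proc n
    ∂       : Ports → Proc n → Proc n
    hide    : Ports → Proc n → Proc n  -- the abstraction operator τ_C

  record Spec : Set where
    field
      #ids    : ℕ
      def     : Fin #ids → Proc #ids
      initial : Fin #ids

  data Guarded {n : ℕ} : Proc n → Set where
    𝟎    : Guarded 𝟎
    𝟏    : Guarded 𝟏
    _·_  : ∀ a p → Guarded (a · p)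
    _+_  : ∀ {p q} → Guarded p → Guarded q → Guarded (p + q)
    _∥_  : ∀ {p q} → Guarded p → Guarded q → Guarded (p ∥ q)
    θ    : ∀ {p} → Guarded p → Guarded (θ p)
    ρ    : ∀ {f fτ p} → Guarded p → Guarded (ρ f fτ p)
    ∂    : ∀ {C p} → Guarded p → Guarded (∂ C p)
    hide : ∀ {C p} → Guarded p → Guarded (hide C p)

  WeaklyGuarded : Spec → Set
  WeaklyGuarded Γ = ∀ X → Guarded (Spec.def Γ X)

  module Semantics (Γ : Spec) where
    open Spec Γ

    P : Set
    P = Proc #ids

    data _↓ : P → Set where
      𝟏     : 𝟏 ↓
      +ˡ    : ∀ {p q} → p ↓ → (p + q) ↓
      +ʳ    : ∀ {p q} → q ↓ → (p + q) ↓
      _∥_   : ∀ {p q} → p ↓ → q ↓ → (p ∥ q) ↓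
      var   : ∀ {X} → def X ↓ → var X ↓
      θ     : ∀ {p} → p ↓ → θ p ↓
      ρ     : ∀ {f fτ p} → p ↓ → ρ f fτ p ↓
      ∂     : ∀ {C p} → p ↓ → ∂ C p ↓
      hide  : ∀ {C p} → p ↓ → hide C p ↓

    TransitionRelation : Set₁
    TransitionRelation = P → Label Act → P → Set

    -- Derivability by the transition rules, where the negative premises of
    -- the rule for θ are evaluated in a given relation T.
    data Derivable (T : TransitionRelation) : TransitionRelation where
      prefix : ∀ {a p} → Derivable T (a · p) a p
      +ˡ     : ∀ {p q a p′} → Derivable T p a p′ → Derivable T (p + q) a p′
      +ʳ     : ∀ {p q a p′} → Derivable T p a p′ → Derivable T (q + p) a p′
      ∥ˡ     : ∀ {p q a p′} → Derivable T p a p′ → Derivable T (p ∥ q) a (p′ ∥ q)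
      ∥ʳ     : ∀ {p q a p′} → Derivable T p a p′ → Derivable T (q ∥ p) a (q ∥ p′)
      commˡ  : ∀ {p q c v p′ q′} →
               Derivable T p (just (c ! v)) p′ → Derivable T q (just (c ⁇ v)) q′ →
               Derivable T (p ∥ q) (just (c ⟨ v ⟩)) (p′ ∥ q′)
      commʳ  : ∀ {p q c v p′ q′} →
               Derivable T p (just (c ! v)) p′ → Derivable T q (just (c ⁇ v)) q′ →
               Derivable T (q ∥ p) (just (c ⟨ v ⟩)) (q′ ∥ p′)
      var    : ∀ {X a p′} → Derivable T (def X) a p′ → Derivable T (var X) a p′
      θ      : ∀ {p a p′} → Derivable T p a p′ →
               (∀ b → a ≺ b → ¬ (∃[ p″ ] T p b p″)) →
               Derivable T (θ p) a (θ p′)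
      ρ      : ∀ {f fτ p a p′} → Derivable T p a p′ →
               Derivable T (ρ f fτ p) (f a) (ρ f fτ p′)
      ∂      : ∀ {C p a p′} → Derivable T p a p′ → ¬ COM C a →
               Derivable T (∂ C p) a (∂ C p′)
      hideτ  : ∀ {C p a p′} → Derivable T p a p′ → Communication C a →
               Derivable T (hide C p) τ (hide C p′)
      hide   : ∀ {C p a p′} → Derivable T p a p′ → ¬ Communication C a →
               Derivable T (hide C p) a (hide C p′)

    _≐_ : TransitionRelation → TransitionRelation → Set
    T ≐ T′ = ∀ p a p′ → T p a p′ ⇔ T′ p a p′

    SatisfiesRules : TransitionRelation → Set
    SatisfiesRules T = T ≐ Derivable T

    -- Number of nested occurrences of θ that are relevant for the initial
    -- transitions of an expression, given that number for the identifiers.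
    depthIn : (Fin #ids → ℕ) → P → ℕ
    depthIn E 𝟎            = 0
    depthIn E 𝟏            = 0
    depthIn E (a · p)      = 0
    depthIn E (p + q)      = depthIn E p ⊔ depthIn E q
    depthIn E (p ∥ q)      = depthIn E p ⊔ depthIn E q
    depthIn E (var X)      = E X
    depthIn E (θ p)        = suc (depthIn E p)
    depthIn E (ρ f fτ p)   = depthIn E p
    depthIn E (∂ C p)      = depthIn E p
    depthIn E (hide C p)   = depthIn E p

    depth : P → ℕ
    depth = depthIn (λ X → depthIn (λ _ → 0) (def X))

    Stratum : ℕ → TransitionRelation
    Stratum zero    = λ _ _ _ → ⊥
    Stratum (suc k) = Derivable (Stratum k)

    -- Stratification by depth.  For weakly guarded Γ this is the unique
    -- relation satisfying the rules: see satisfiesRules and unique below.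
    _—[_]→_ : TransitionRelation
    p —[ a ]→ p′ = Stratum (suc (depth p)) p a p′

    graph : ProcessGraph Act
    graph = record
      { lts = record
        { State     = P
        ; _—[_]→_   = _—[_]→_
        ; Accepting = _↓
        }
      ; root = var initial
      }

    module _ (wg : WeaklyGuarded Γ) where

      private
        depthIn-guarded : ∀ {E E′ p} → Guarded p → depthIn E p ≡ depthIn E′ p
        depthIn-guarded 𝟎        = refl
        depthIn-guarded 𝟏        = refl
        depthIn-guarded (a · p)  = refl
        depthIn-guarded (g + h)  = cong₂ _⊔_ (depthIn-guarded g) (depthIn-guarded h)
        depthIn-guarded (g ∥ h)  = cong₂ _⊔_ (depthIn-guarded g) (depthIn-guarded h)
        depthIn-guarded (θ g)    = cong suc (depthIn-guarded g)
        depthIn-guarded (ρ g)    = depthIn-guarded g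
        depthIn-guarded (∂ g)    = depthIn-guarded g
        depthIn-guarded (hide g) = depthIn-guarded g

        depth-def : ∀ X → depth (def X) ≡ depth (var X)
        depth-def X = depthIn-guarded (wg X)

        ⊔ˡ : ∀ {m n k} → m ⊔ n ≤ k → m ≤ k
        ⊔ˡ {m} {n} = ≤-trans (m≤m⊔n m n)

        ⊔ʳ : ∀ {m n k} → m ⊔ n ≤ k → n ≤ k
        ⊔ʳ {m} {n} = ≤-trans (m≤n⊔m m n)

        -- Derivability for p depends on T only below the depth of p.
        transfer : ∀ {T T′ : TransitionRelation} {k} →
                   (∀ p → depth p < k → ∀ a p′ → T′ p a p′ → T p a p′) →
                   ∀ {p a p′} → depth p ≤ k → Derivable T p a p′ → Derivable T′ p a p′
        transfer h l prefix          = prefix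
        transfer h l (+ˡ {p} {q} x)  = +ˡ (transfer h (⊔ˡ {depth p} {depth q} l) x)
        transfer h l (+ʳ {p} {q} x)  = +ʳ (transfer h (⊔ʳ {depth q} {depth p} l) x)
        transfer h l (∥ˡ {p} {q} x)  = ∥ˡ (transfer h (⊔ˡ {depth p} {depth q} l) x)
        transfer h l (∥ʳ {p} {q} x)  = ∥ʳ (transfer h (⊔ʳ {depth q} {depth p} l) x)
        transfer h l (commˡ {p} {q} x y) =
          commˡ (transfer h (⊔ˡ {depth p} {depth q} l) x) (transfer h (⊔ʳ {depth p} {depth q} l) y)
        transfer h l (commʳ {p} {q} x y) =
          commʳ (transfer h (⊔ʳ {depth q} {depth p} l) x) (transfer h (⊔ˡ {depth q} {depth p} l) y)
        transfer h l (var {X} x)     = var (transfer h (≤-trans (≤-reflexive (depth-def X)) l) x)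
        transfer h (s≤s l) (θ {p} x n) =
          θ (transfer h (≤-trans l (n≤1+n _)) x)
            (λ b a≺b (p″ , y) → n b a≺b (p″ , h p (s≤s l) b p″ y))
        transfer h l (ρ x)           = ρ (transfer h l x)
        transfer h l (∂ x n)         = ∂ (transfer h l x) n
        transfer h l (hideτ x c)     = hideτ (transfer h l x) c
        transfer h l (hide x n)      = hide (transfer h l x) n

        stable : ∀ i j {p a p′} → depth p ≤ i → depth p ≤ j →
                 Stratum (suc i) p a p′ → Stratum (suc j) p a p′
        stable i j {p} l m = transfer (below i j l m) ≤-refl
          where
          below : ∀ i j → depth p ≤ i → depth p ≤ j →
                  ∀ q → depth q < depth p → ∀ a q′ → Stratum j q a q′ → Stratum i q a q′
          below zero    j       l m q lt a q′ x with () ← ≤-trans lt l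
          below (suc i) zero    l m q lt a q′ ()
          below (suc i) (suc j) l m q lt a q′ x with ≤-trans lt l | ≤-trans lt m
          ... | s≤s l′ | s≤s m′ = stable j i m′ l′ x

        stratum⇔→ : ∀ k q → depth q < k → ∀ a q′ → Stratum k q a q′ ⇔ q —[ a ]→ q′
        stratum⇔→ (suc k) q (s≤s l) a q′ =
          mk⇔ (stable k (depth q) l ≤-refl) (stable (depth q) k ≤-refl l)

      satisfiesRules : SatisfiesRules _—[_]→_
      satisfiesRules p a p′ = mk⇔
        (transfer (λ q lt b q′ → Equivalence.from (stratum⇔→ (depth p) q lt b q′)) ≤-refl)
        (transfer (λ q lt b q′ → Equivalence.to (stratum⇔→ (depth p) q lt b q′)) ≤-refl)

      private
        agree : ∀ {T T′} → SatisfiesRules T → SatisfiesRules T′ →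
                ∀ k p → depth p < k → ∀ a p′ → T p a p′ → T′ p a p′
        agree r r′ (suc k) p (s≤s l) a p′ x =
          Equivalence.from (r′ p a p′)
            (transfer (agree r′ r k) l (Equivalence.to (r p a p′) x))

      unique : ∀ {T T′} → SatisfiesRules T → SatisfiesRules T′ → T ≐ T′
      unique r r′ p a p′ = mk⇔
        (agree r r′ (suc (depth p)) p ≤-refl a p′)
        (agree r′ r (suc (depth p)) p ≤-refl a p′)

{-# OPTIONS --safe #-}

-- A configuration (s, x) is represented by ρ(∂(θ(Xₛ ∥ cells))), with one cell
-- for each element of x, and every transition of the automaton is matched by
-- exactly one step.  A transition that removes d synchronises with a cell for d
-- through the port d; the value passed is the label, which ρ reveals, so that
-- even τ-labelled transitions are visible, and hence harmless, within θ.
-- A transition that tests the absence of d is an action with lower priority than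
-- the receive actions offered by the cells for d; these are blocked by ∂ only
-- outside the scope of θ.  Spent cells remain as copies of 𝟏.
module Submission where

open import Defs
open import Data.Bool.Base using (if_then_else_)
open import Data.Empty using (⊥; ⊥-elim)
open import Data.Fin.Base using (Fin; zero; suc)
open import Data.Fin.Properties using (_≟_)
open import Data.Fin.Subset using (_∈_; ⊤)
open import Data.Fin.Subset.Properties using (_∈?_; ∈⊤)
open import Data.List.Base as List using (List; []; _∷_; _++_; foldr; allFin)
open import Data.List.Membership.Propositional using () renaming (_∈_ to _∈ₗ_)
open import Data.List.Membership.Propositional.Properties using (∈-allFin)
open import Data.List.Relation.Unary.Any using (here; there)
open import Data.Maybe.Base using (just; map)
open import Data.Nat.Base as ℕ using (ℕ; zero; suc)
open import Data.Nat.Properties as ℕ using ()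
open import Data.Product.Base using (Σ; Σ-syntax; ∃-syntax; _×_; _,_)
open import Data.Sum.Base using (_⊎_; inj₁; inj₂)
open import Data.Vec.Base using ([]; _∷_)
open import Data.Vec.Properties
  using (∷-injective; lookup-replicate; zipWith-assoc; zipWith-comm; zipWith-identityˡ)
open import Function.Bundles using (_↣_; mk↣; module Injection; module Equivalence)
open import Level using (0ℓ)
open import Relation.Binary.Construct.Closure.ReflexiveTransitive using (ε)
import Relation.Binary.Construct.Closure.Transitive as Plus
open import Relation.Binary.Core using (Rel)
open import Relation.Binary.Definitions using (Symmetric)
open import Relation.Binary.PropositionalEquality.Core
  using (_≡_; refl; sym; trans; cong; cong₂; subst)
open import Relation.Binary.PropositionalEquality.Properties using (isEquivalence; module ≡-Reasoning)
open import Relation.Nullary.Decidable.Core using (yes; no; does)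
open import Relation.Nullary.Negation.Core using (¬_; contradiction)

-- Strong bisimulations as divergence-preserving branching bisimulations

module _ {A : Set} (L : LTS A) where
  open LTS L

  -- Each step is answered by exactly one step, so the silent prefixes are empty. For divergence it
  -- suffices to answer the first step of the infinite sequence, which gives index 1.
  strong⇒bisimilar : (R : Rel State 0ℓ) → Symmetric R →
    (∀ {s t a s′} → R s t → s —[ a ]→ s′ → ∃[ t′ ] t —[ a ]→ t′ × R s′ t′) →
    (∀ {s t} → R s t → Accepting s → Accepting t) →
    ∀ {s t} → R s t → StatesBisimilar L s t
  strong⇒bisimilar R symR step accept r = R , record
    { symmetric  = symR
    ; transition = λ r x → let t′ , y , r′ = step r x in _ , t′ , ε , inj₁ y , r , r′
    ; acceptance = λ r x → _ , ε , accept r x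
    } , divergence , r
    where
    divergence : DivergencePreserving L R
    divergence σ t steps rel =
      let t′ , y , r′ = step (rel 0) (steps 0) in t′ , Plus.[ y ] , 1 , r′

-- Arithmetic of bags

module _ {n : ℕ} where

  ∪-assoc : (x y z : Bag n) → (x ∪ y) ∪ z ≡ x ∪ (y ∪ z)
  ∪-assoc = zipWith-assoc ℕ.+-assoc

  ∪-comm : (x y : Bag n) → x ∪ y ≡ y ∪ x
  ∪-comm = zipWith-comm ℕ.+-comm

  ∪-identityˡ : (x : Bag n) → ∅ ∪ x ≡ x
  ∪-identityˡ = zipWith-identityˡ λ _ → refl

  ∪-identityʳ : (x : Bag n) → x ∪ ∅ ≡ x
  ∪-identityʳ x = trans (∪-comm x ∅) (∪-identityˡ x)

  ∪-swap : (x y z : Bag n) → x ∪ (y ∪ z) ≡ y ∪ (x ∪ z)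
  ∪-swap x y z = begin
    x ∪ (y ∪ z) ≡⟨ ∪-assoc x y z ⟨
    (x ∪ y) ∪ z ≡⟨ cong (_∪ z) (∪-comm x y) ⟩
    (y ∪ x) ∪ z ≡⟨ ∪-assoc y x z ⟩
    y ∪ (x ∪ z) ∎
    where open ≡-Reasoning

∈-⁅⁆∪ : ∀ {n} (d : Fin n) y → ¬ (d ∉ᵇ (⁅ d ⁆ ∪ y))
∈-⁅⁆∪ zero    (k ∷ y) ()
∈-⁅⁆∪ (suc d) (k ∷ y) = ∈-⁅⁆∪ d y

∉⊎present : ∀ {n} (d : Fin n) x → d ∉ᵇ x ⊎ (∃[ y ] x ≡ ⁅ d ⁆ ∪ y)
∉⊎present zero    (zero ∷ x)  = inj₁ refl
∉⊎present zero    (suc k ∷ x) = inj₂ (k ∷ x , cong (suc k ∷_) (sym (∪-identityˡ x)))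
∉⊎present (suc d) (k ∷ x) with ∉⊎present d x
... | inj₁ d∉x      = inj₁ d∉x
... | inj₂ (y , eq) = inj₂ (k ∷ y , cong (k ∷_) eq)

∅≢⁅⁆∪ : ∀ {n} (d : Fin n) {y} → ¬ (∅ ≡ ⁅ d ⁆ ∪ y)
∅≢⁅⁆∪ d {y} eq = ∈-⁅⁆∪ d y (subst (d ∉ᵇ_) eq (lookup-replicate d 0))

⁅⁆≡⁅⁆∪ : ∀ {n} (c d : Fin n) {y} → ⁅ c ⁆ ≡ ⁅ d ⁆ ∪ y → c ≡ d × y ≡ ∅
⁅⁆≡⁅⁆∪ zero zero {k ∷ y} eq with ∷-injective eq
... | 1≡1+k , ∅≡∅∪y =
  refl , cong₂ _∷_ (sym (ℕ.suc-injective 1≡1+k)) (trans (sym (∪-identityˡ y)) (sym ∅≡∅∪y))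
⁅⁆≡⁅⁆∪ zero (suc d) {k ∷ y} eq with ∷-injective eq
... | _ , eq′ = contradiction eq′ (∅≢⁅⁆∪ d)
⁅⁆≡⁅⁆∪ (suc c) zero {k ∷ y} ()
⁅⁆≡⁅⁆∪ (suc c) (suc d) {k ∷ y} eq with ∷-injective eq
... | 0≡k , eq′ with ⁅⁆≡⁅⁆∪ c d eq′
... | refl , y≡∅ = refl , cong₂ _∷_ (sym 0≡k) y≡∅

-- Serves to locate the side of a parallel composition from which `d` is taken. At position `d` a
-- positive multiplicity on the left is decremented in preference to one on the right.
∪≡⁅⁆∪ : ∀ {n} (d : Fin n) x y {z} → x ∪ y ≡ ⁅ d ⁆ ∪ z →
        (∃[ w ] x ≡ ⁅ d ⁆ ∪ w × w ∪ y ≡ z) ⊎ (∃[ w ] y ≡ ⁅ d ⁆ ∪ w × x ∪ w ≡ z)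
∪≡⁅⁆∪ zero (zero ∷ x) (zero ∷ y) {k ∷ z} ()
∪≡⁅⁆∪ zero (suc m ∷ x) (n ∷ y) {k ∷ z} eq with ∷-injective eq
... | eq₀ , eq′ = inj₁ (m ∷ x , cong (suc m ∷_) (sym (∪-identityˡ x)) ,
  cong₂ _∷_ (ℕ.suc-injective eq₀) (trans eq′ (∪-identityˡ z)))
∪≡⁅⁆∪ zero (zero ∷ x) (suc n ∷ y) {k ∷ z} eq with ∷-injective eq
... | eq₀ , eq′ = inj₂ (n ∷ y , cong (suc n ∷_) (sym (∪-identityˡ y)) ,
  cong₂ _∷_ (ℕ.suc-injective eq₀) (trans eq′ (∪-identityˡ z)))
∪≡⁅⁆∪ (suc d) (m ∷ x) (n ∷ y) {k ∷ z} eq with ∷-injective eq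
... | eq₀ , eq′ with ∪≡⁅⁆∪ d x y eq′
... | inj₁ (w , x≡ , ≡z) = inj₁ (m ∷ w , cong (m ∷_) x≡ , cong₂ _∷_ eq₀ ≡z)
... | inj₂ (w , y≡ , ≡z) = inj₂ (n ∷ w , cong (n ∷_) y≡ , cong₂ _∷_ eq₀ ≡z)

-- Enumerating bags by lists

fromList : ∀ {n} → List (Fin n) → Bag n
fromList = foldr (λ d x → ⁅ d ⁆ ∪ x) ∅

toList : ∀ {n} → Bag n → List (Fin n)
toList []      = []
toList (k ∷ x) = List.replicate k zero ++ List.map suc (toList x)

fromList-map-suc : ∀ {n} (ds : List (Fin n)) → fromList (List.map suc ds) ≡ 0 ∷ fromList ds
fromList-map-suc []       = refl
fromList-map-suc (d ∷ ds) = cong (⁅ suc d ⁆ ∪_) (fromList-map-suc ds)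

fromList-replicate-++ : ∀ {n} k {ds : List (Fin (suc n))} {m x} → fromList ds ≡ m ∷ x →
                        fromList (List.replicate k zero ++ ds) ≡ (k ℕ.+ m) ∷ x
fromList-replicate-++ zero    eq = eq
fromList-replicate-++ (suc k) {x = x} eq =
  trans (cong (⁅ zero ⁆ ∪_) (fromList-replicate-++ k eq)) (cong (_ ∷_) (∪-identityˡ x))

fromList∘toList : ∀ {n} (x : Bag n) → fromList (toList x) ≡ x
fromList∘toList []      = refl
fromList∘toList (k ∷ x) = trans
  (fromList-replicate-++ k (fromList-map-suc (toList x)))
  (cong₂ _∷_ (ℕ.+-identityʳ k) (fromList∘toList x))

-- The recursive specification

module Construction (M : PPDA) where
  open PPDA M

  -- inj₁ a is the input a itself; inj₂ (a , d) is the action of an a-labelled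
  -- transition that tests the absence of d.
  Basic : Set
  Basic = Input ⊎ (Label Input × Datum)

  BCPAct : Set
  BCPAct = Action Basic #data (suc #inputs)

  -- `test≺τ` is forced by `below⇒below-τ`. It never blocks a test, because control and cells
  -- perform no `τ` inside `θ`.
  data _≺_ : Rel (Label BCPAct) 0ℓ where
    test≺receive : ∀ {a d v} → just (basic (inj₂ (a , d))) ≺ just (d ⁇ v)
    test≺τ       : ∀ {a d}   → just (basic (inj₂ (a , d))) ≺ τ

  signature : Signature
  signature = record
    { Basic   = Basic
    ; #ports  = #data
    ; #values = suc #inputs
    ; _≺_     = _≺_
    ; isStrictPartialOrder = record
      { isEquivalence = isEquivalence
      ; irrefl        = λ { refl () }
      ; trans         = λ { test≺receive () ; test≺τ () }
      ; <-resp-≈      = (λ { refl x → x }) , (λ { refl x → x })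
      }
    ; τ-not-below   = λ ()
    ; below⇒below-τ = λ { test≺receive → test≺τ ; test≺τ → test≺τ }
    }

  open BCP signature

  Value : Set
  Value = Fin (suc #inputs)

  encode : Label Input → Value
  encode τ        = zero
  encode (just a) = suc a

  decode : Value → Label Input
  decode zero    = τ
  decode (suc a) = just a

  decode∘encode : ∀ a → decode (encode a) ≡ a
  decode∘encode τ        = refl
  decode∘encode (just a) = refl

  input : Input → BCPAct
  input a = basic (inj₁ a)

  inputs : Input ↣ BCPAct
  inputs = mk↣ {to = input} λ { refl → refl }

  -- Silent steps arise only here, outside `θ`. Sends and receives fall under the last clause, but
  -- `∂` has already blocked them.
  reveal : Label BCPAct → Label BCPAct
  reveal (just (basic (inj₂ (a , d)))) = map input a
  reveal (just (d ⟨ v ⟩))              = map input (decode v)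
  reveal b                             = b

  -- Identifier `zero` is the initial one and `suc s` is the control in state `s`. Keeping them
  -- apart prevents a return to the initial state from nesting another `context`.
  #vars : ℕ
  #vars = suc #states

  Term : Set
  Term = Proc #vars

  ∑ : {A : Set} → (A → Term) → List A → Term
  ∑ f = foldr (λ x p → f x + p) 𝟎

  offer : Datum → Value → Term
  offer d v = just (d ⁇ v) · 𝟏

  -- The summand `𝟏` keeps a full cell from obstructing acceptance. All values are offered because
  -- the label is chosen by the sender.
  cell : Datum → Term
  cell d = 𝟏 + ∑ (offer d) (allFin (suc #inputs))

  cells : List Datum → Term
  cells = foldr (λ d p → cell d ∥ p) 𝟏

  action : Label Input → Signed Datum → Label BCPAct
  action a +[ d ] = just (d ! encode a)
  action a -[ d ] = just (basic (inj₂ (a , d)))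

  Transition : Set
  Transition = State × Label Input × Signed Datum × Bag #data × State

  -- The continuation spawns cells only for the inserted bag; the older cells stand beside it in the
  -- surrounding parallel composition.
  branch : State → Transition → Term
  branch s (r , a , e , x , t) =
    if does (s ≟ r) then action a e · (var (suc t) ∥ cells (toList x)) else 𝟎

  acceptance : State → Term
  acceptance s = if does (s ∈? accepting) then 𝟏 else 𝟎

  body : State → Term
  body s = acceptance s + ∑ (branch s) transitions

  context : Term → Term
  context p = ρ reveal refl (∂ ⊤ (θ p))

  definition : Fin #vars → Term
  definition zero    = context (body initial)
  definition (suc s) = body s

  Γ : Spec
  Γ = record { #ids = #vars ; def = definition ; initial = zero }

  ∑-guarded : {A : Set} {f : A → Term} (xs : List A) → (∀ x → Guarded (f x)) → Guarded (∑ f xs)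
  ∑-guarded []       g = 𝟎
  ∑-guarded (x ∷ xs) g = g x + ∑-guarded xs g

  branch-guarded : ∀ s t → Guarded (branch s t)
  branch-guarded s (r , a , e , x , t) with s ≟ r
  ... | yes _ = _·_ _ _
  ... | no  _ = 𝟎

  body-guarded : ∀ s → Guarded (body s)
  body-guarded s = acceptance-guarded + ∑-guarded transitions (branch-guarded s)
    where
    acceptance-guarded : Guarded (acceptance s)
    acceptance-guarded with s ∈? accepting
    ... | yes _ = 𝟏
    ... | no  _ = 𝟎

  guarded : WeaklyGuarded Γ
  guarded zero    = ρ (∂ (θ (body-guarded initial)))
  guarded (suc s) = body-guarded s

  -- Shape and acceptance of the terms inside the context

  open Semantics Γ renaming (graph to Γ-graph)

  -- Holds p x: p is a parallel composition of cells with contents x.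
  data Holds : P → Bag #data → Set where
    spent : Holds 𝟏 ∅
    full  : ∀ d → Holds (cell d) ⁅ d ⁆
    _∥_   : ∀ {p q x y} → Holds p x → Holds q y → Holds (p ∥ q) (x ∪ y)

  -- Runs p s x: p is the control in state s next to cells with contents x.
  data Runs : P → State → Bag #data → Set where
    var      : ∀ s → Runs (var (suc s)) s ∅
    unfolded : ∀ s → Runs (body s) s ∅
    _∥_      : ∀ {p q s x y} → Runs p s x → Holds q y → Runs (p ∥ q) s (x ∪ y)

  cells-holds : ∀ ds → Holds (cells ds) (fromList ds)
  cells-holds []       = spent
  cells-holds (d ∷ ds) = full d ∥ cells-holds ds

  start-runs : ∀ s x → Runs (var (suc s) ∥ cells (toList x)) s x
  start-runs s x = subst (Runs _ s) (trans (∪-identityˡ _) (fromList∘toList x))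
                     (var s ∥ cells-holds (toList x))

  ∑-↓⁻ : {A : Set} {f : A → Term} (xs : List A) → (∀ x → ¬ (f x ↓)) → ¬ (∑ f xs ↓)
  ∑-↓⁻ (x ∷ xs) n (+ˡ a) = n x a
  ∑-↓⁻ (x ∷ xs) n (+ʳ a) = ∑-↓⁻ xs n a

  body-↓⁺ : ∀ {s} → s ∈ accepting → body s ↓
  body-↓⁺ {s} s∈ = +ˡ accepts
    where
    accepts : acceptance s ↓
    accepts with s ∈? accepting
    ... | yes _  = 𝟏
    ... | no  s∉ = contradiction s∈ s∉

  body-↓⁻ : ∀ {s} → body s ↓ → s ∈ accepting
  body-↓⁻ {s} (+ˡ a) with s ∈? accepting
  ... | yes s∈ = s∈
  body-↓⁻ {s} (+ˡ ()) | no _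
  body-↓⁻ {s} (+ʳ a) = ⊥-elim (∑-↓⁻ transitions branch-↓⁻ a)
    where
    branch-↓⁻ : ∀ t → ¬ (branch s t ↓)
    branch-↓⁻ (r , _) a with s ≟ r
    branch-↓⁻ (r , _) () | yes _
    branch-↓⁻ (r , _) () | no  _

  holds-↓ : ∀ {p x} → Holds p x → p ↓
  holds-↓ spent    = 𝟏
  holds-↓ (full d) = +ˡ 𝟏
  holds-↓ (h ∥ k)  = holds-↓ h ∥ holds-↓ k

  runs-↓⁺ : ∀ {p s x} → Runs p s x → s ∈ accepting → p ↓
  runs-↓⁺ (var s)  s∈ = var (body-↓⁺ s∈)
  runs-↓⁺ (unfolded s) s∈ = body-↓⁺ s∈
  runs-↓⁺ (r ∥ h)  s∈ = runs-↓⁺ r s∈ ∥ holds-↓ h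

  runs-↓⁻ : ∀ {p s x} → Runs p s x → p ↓ → s ∈ accepting
  runs-↓⁻ (var s)  (var a) = body-↓⁻ a
  runs-↓⁻ (unfolded s) a       = body-↓⁻ a
  runs-↓⁻ (r ∥ h)  (a ∥ _) = runs-↓⁻ r a

  -- Transitions of control and cells

  data HeapMove (x : Bag #data) : Label BCPAct → P → Set where
    receive : ∀ {d v y p} → x ≡ ⁅ d ⁆ ∪ y → Holds p y → HeapMove x (just (d ⁇ v)) p

  -- In `send` the bag `x` is still complete, since the datum disappears only when a cell takes
  -- part, as in `sync`. No constructor has label `τ`.
  data Move (s : State) (x : Bag #data) : Label BCPAct → P → Set where
    send    : ∀ {a d x′ s′ p} → (s , a , +[ d ] , x′ , s′) ∈ₗ transitions →
              Runs p s′ (x′ ∪ x) → Move s x (just (d ! encode a)) p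
    test    : ∀ {a d x′ s′ p} → (s , a , -[ d ] , x′ , s′) ∈ₗ transitions →
              Runs p s′ (x′ ∪ x) → Move s x (just (basic (inj₂ (a , d)))) p
    receive : ∀ {d v y p} → x ≡ ⁅ d ⁆ ∪ y → Runs p s y → Move s x (just (d ⁇ v)) p
    sync    : ∀ {a d y x′ s′ p} → (s , a , +[ d ] , x′ , s′) ∈ₗ transitions →
              x ≡ ⁅ d ⁆ ∪ y → Runs p s′ (x′ ∪ y) → Move s x (just (d ⟨ encode a ⟩)) p

  heapMoveˡ : ∀ {x y b p q} → HeapMove x b p → Holds q y → HeapMove (x ∪ y) b (p ∥ q)
  heapMoveˡ {y = y} (receive {d} {y = z} refl h) k = receive (∪-assoc ⁅ d ⁆ z y) (h ∥ k)

  heapMoveʳ : ∀ {x y b p q} → HeapMove x b p → Holds q y → HeapMove (y ∪ x) b (q ∥ p)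
  heapMoveʳ {y = y} (receive {d} {y = z} refl h) k = receive (∪-swap y ⁅ d ⁆ z) (k ∥ h)

  runs-∪-∥ : ∀ {p q s} x y {z} → Runs p s (x ∪ y) → Holds q z → Runs (p ∥ q) s (x ∪ (y ∪ z))
  runs-∪-∥ x y {z} r h = subst (Runs _ _) (∪-assoc x y z) (r ∥ h)

  moveˡ : ∀ {s x y b p q} → Move s x b p → Holds q y → Move s (x ∪ y) b (p ∥ q)
  moveˡ (send {x′ = x′} t∈ r)               h = send t∈ (runs-∪-∥ x′ _ r h)
  moveˡ (test {x′ = x′} t∈ r)               h = test t∈ (runs-∪-∥ x′ _ r h)
  moveˡ (receive {d} {y = z} refl r)        h = receive (∪-assoc ⁅ d ⁆ z _) (r ∥ h)
  moveˡ (sync {d = d} {z} {x′} t∈ refl r)   h =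
    sync t∈ (∪-assoc ⁅ d ⁆ z _) (runs-∪-∥ x′ z r h)

  module _ {T : TransitionRelation} where

    ∑⁻ : ∀ {A : Set} {f : A → Term} xs {b p} → Derivable T (∑ f xs) b p →
         ∃[ x ] x ∈ₗ xs × Derivable T (f x) b p
    ∑⁻ (x ∷ xs) (+ˡ u) = x , here refl , u
    ∑⁻ (x ∷ xs) (+ʳ u) with ∑⁻ xs u
    ... | y , y∈ , w = y , there y∈ , w

    ∑⁺ : ∀ {A : Set} {f : A → Term} {xs x b p} → x ∈ₗ xs → Derivable T (f x) b p →
         Derivable T (∑ f xs) b p
    ∑⁺ (here refl) u = +ˡ u
    ∑⁺ (there x∈)  u = +ʳ (∑⁺ x∈ u)

    body⁻ : ∀ {s b p} → Derivable T (body s) b p → Move s ∅ b p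
    body⁻ {s} (+ˡ u) with s ∈? accepting
    body⁻ {s} (+ˡ ()) | yes _
    body⁻ {s} (+ˡ ()) | no  _
    body⁻ {s} (+ʳ u) with ∑⁻ {f = branch s} transitions u
    ... | (r , a , e , x , t) , t∈ , w with s ≟ r
    body⁻ (+ʳ u) | (s , a , +[ d ] , x , t) , t∈ , prefix | yes refl =
      send t∈ (subst (Runs _ t) (sym (∪-identityʳ x)) (start-runs t x))
    body⁻ (+ʳ u) | (s , a , -[ d ] , x , t) , t∈ , prefix | yes refl =
      test t∈ (subst (Runs _ t) (sym (∪-identityʳ x)) (start-runs t x))
    body⁻ (+ʳ u) | (r , a , e , x , t) , t∈ , () | no _

    body⁺ : ∀ {s a e x t} → (s , a , e , x , t) ∈ₗ transitions →
            ∃[ p ] Derivable T (body s) (action a e) p × Runs p t (x ∪ ∅)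
    body⁺ {s} {a} {e} {x} {t} t∈ =
      _ , +ʳ (∑⁺ {f = branch s} t∈ fires) , subst (Runs _ t) (sym (∪-identityʳ x)) (start-runs t x)
      where
      fires : Derivable T (branch s (s , a , e , x , t)) (action a e)
                (var (suc t) ∥ cells (toList x))
      fires with s ≟ s
      ... | yes _   = prefix
      ... | no  s≢s = contradiction refl s≢s

    holds⁻ : ∀ {p x b p′} → Holds p x → Derivable T p b p′ → HeapMove x b p′
    holds⁻ (full d) (+ʳ u) with ∑⁻ {f = offer d} (allFin _) u
    ... | v , _ , prefix = receive (sym (∪-identityʳ ⁅ d ⁆)) spent
    holds⁻ (h ∥ k) (∥ˡ u) = heapMoveˡ (holds⁻ h u) k
    holds⁻ (h ∥ k) (∥ʳ u) = heapMoveʳ (holds⁻ k u) h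
    -- Cells only receive, so they cannot communicate with each other.
    holds⁻ (h ∥ k) (commˡ u w) with () ← holds⁻ h u
    holds⁻ (h ∥ k) (commʳ u w) with () ← holds⁻ k u

    holds-receive : ∀ {p x} d {y} v → Holds p x → x ≡ ⁅ d ⁆ ∪ y →
                    ∃[ p′ ] Derivable T p (just (d ⁇ v)) p′ × Holds p′ y
    holds-receive d v spent eq = contradiction eq (∅≢⁅⁆∪ d)
    holds-receive d v (full c) eq with ⁅⁆≡⁅⁆∪ c d eq
    ... | refl , refl = 𝟏 , +ʳ (∑⁺ {f = offer d} (∈-allFin v) prefix) , spent
    holds-receive d v (_∥_ {x = x} {y} h k) eq with ∪≡⁅⁆∪ d x y eq
    ... | inj₁ (w , x≡ , refl) =
      let _ , u , h′ = holds-receive d v h x≡ in _ , ∥ˡ u , h′ ∥ k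
    ... | inj₂ (w , y≡ , refl) =
      let _ , u , k′ = holds-receive d v k y≡ in _ , ∥ʳ u , h ∥ k′

    runs⁻ : ∀ {p s x b p′} → Runs p s x → Derivable T p b p′ → Move s x b p′
    runs⁻ (var s)  (var u) = body⁻ u
    runs⁻ (unfolded s) u       = body⁻ u
    runs⁻ (r ∥ h) (∥ˡ u)   = moveˡ (runs⁻ r u) h
    runs⁻ (_∥_ {x = x} r h) (∥ʳ u) with holds⁻ h u
    ... | receive {d} {y = z} refl h′ = receive (∪-swap x ⁅ d ⁆ z) (r ∥ h′)
    runs⁻ (_∥_ {x = x} r h) (commˡ u w) with runs⁻ r u | holds⁻ h w
    -- Sharing a port forces the cell's datum to be the `d` that the transition removes.
    ... | send {d = d} {x′} t∈ r′ | receive {y = z} refl h′ =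
      sync t∈ (∪-swap x ⁅ d ⁆ z) (runs-∪-∥ x′ x r′ h′)
    runs⁻ (r ∥ h) (commʳ u w) with () ← holds⁻ h u

    -- The control sits leftmost and acts on its own: it can send without a partner and test even
    -- when the datum is present. Excluding this is left to `∂` and `θ`.
    runs-fire : ∀ {p s x a e x′ s′} → Runs p s x → (s , a , e , x′ , s′) ∈ₗ transitions →
                ∃[ p′ ] Derivable T p (action a e) p′ × Runs p′ s′ (x′ ∪ x)
    runs-fire (var s)  t∈ = let _ , u , r = body⁺ t∈ in _ , var u , r
    runs-fire (unfolded s) t∈ = body⁺ t∈
    runs-fire {x′ = x′} (r ∥ h) t∈ =
      let _ , u , r′ = runs-fire r t∈ in _ , ∥ˡ u , runs-∪-∥ x′ _ r′ h

    -- Supplies the competitor that disables a test for `d`; only its existence matters, so the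
    -- target is not described.
    runs-receive : ∀ {p s x} d {y} v → Runs p s x → x ≡ ⁅ d ⁆ ∪ y →
                   ∃[ p′ ] Derivable T p (just (d ⁇ v)) p′
    runs-receive d v (var s)  eq = contradiction eq (∅≢⁅⁆∪ d)
    runs-receive d v (unfolded s) eq = contradiction eq (∅≢⁅⁆∪ d)
    runs-receive d v (_∥_ {x = x} {y} r h) eq with ∪≡⁅⁆∪ d x y eq
    ... | inj₁ (_ , x≡ , _) = let _ , u     = runs-receive d v r x≡ in _ , ∥ˡ u
    ... | inj₂ (_ , y≡ , _) = let _ , u , _ = holds-receive d v h y≡ in _ , ∥ʳ u

    -- The recursion descends to the left as long as `d` is found there; at the node where `d` is
    -- found on the right, the control sends and a cell of the right component receives. A bare
    -- control holds `∅`, so the descent stops before it.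
    runs-sync : ∀ {p s x a d y x′ s′} → Runs p s x → x ≡ ⁅ d ⁆ ∪ y →
                (s , a , +[ d ] , x′ , s′) ∈ₗ transitions →
                ∃[ p′ ] Derivable T p (just (d ⟨ encode a ⟩)) p′ × Runs p′ s′ (x′ ∪ y)
    runs-sync {d = d} (var s)  eq t∈ = contradiction eq (∅≢⁅⁆∪ d)
    runs-sync {d = d} (unfolded s) eq t∈ = contradiction eq (∅≢⁅⁆∪ d)
    runs-sync {a = a} {d = d} {x′ = x′} (_∥_ {x = x} {y} r h) eq t∈ with ∪≡⁅⁆∪ d x y eq
    ... | inj₁ (w , x≡ , refl) =
      let _ , u , r′ = runs-sync r x≡ t∈ in _ , ∥ˡ u , runs-∪-∥ x′ w r′ h
    ... | inj₂ (w , y≡ , refl) =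
      let _ , u , r′ = runs-fire r t∈
          _ , v , h′ = holds-receive d (encode a) h y≡
      in _ , commˡ u v , runs-∪-∥ x′ x r′ h′

  -- Transitions under priority, encapsulation and renaming

  -- Weak guardedness replaces the strata by a fixed point, whose negative premises speak of the
  -- transition relation itself.
  rules⁻ : ∀ {p b p′} → p —[ b ]→ p′ → Derivable _—[_]→_ p b p′
  rules⁻ = Equivalence.to (satisfiesRules guarded _ _ _)

  rules⁺ : ∀ {p b p′} → Derivable _—[_]→_ p b p′ → p —[ b ]→ p′
  rules⁺ = Equivalence.from (satisfiesRules guarded _ _ _)

  -- The initial identifier unfolds to a `context` without being one, hence the case `root`; no
  -- transition leads back to it.
  data Represents : P → Config → Set where
    running : ∀ {p s x} → Runs p s x → Represents (context p) (s , x)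
    root    : Represents (var zero) (initial , ∅)

  represents-↓⁺ : ∀ {p s x} → Represents p (s , x) → s ∈ accepting → p ↓
  represents-↓⁺ (running r) s∈ = ρ (∂ (θ (runs-↓⁺ r s∈)))
  represents-↓⁺ root        s∈ = var (ρ (∂ (θ (body-↓⁺ s∈))))

  represents-↓⁻ : ∀ {p s x} → Represents p (s , x) → p ↓ → s ∈ accepting
  represents-↓⁻ (running r) (ρ (∂ (θ a)))       = runs-↓⁻ r a
  represents-↓⁻ root        (var (ρ (∂ (θ a)))) = body-↓⁻ a

  -- Lone sends and receives are stopped by `∂`, synchronisations are removals, and a test passes
  -- `θ` only if its datum is absent.
  context⁻ : ∀ {p s x b q} → Runs p s x → Derivable _—[_]→_ (context p) b q →
             ∃[ κ ] (∃[ a ] b ≡ map input a × Step (s , x) a κ) × Represents q κ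
  context⁻ {s = s} {x} r (ρ (∂ (θ u higher) ∉COM)) with runs⁻ r u
  ... | send t∈ r′     = contradiction (send _ ∈⊤) ∉COM
  ... | receive eq r′  = contradiction (receive _ ∈⊤) ∉COM
  ... | sync {a} {y = y} t∈ refl r′ =
    _ , (a , cong (map input) (decode∘encode a) , remove y t∈) , running r′
  ... | test {a} {d} t∈ r′ with ∉⊎present d x
  ...   | inj₁ d∉x      = _ , (a , refl , absent x t∈ d∉x) , running r′
  -- A cell for `d` offers a receive that outranks the test; the value `zero` is an arbitrary
  -- choice.
  ...   | inj₂ (y , eq) = contradiction
    (let _ , w = runs-receive d zero r eq in _ , rules⁺ w) (higher _ test≺receive)

  context⁺ : ∀ {p s x a κ} → Runs p s x → Step (s , x) a κ →
             ∃[ q ] Derivable _—[_]→_ (context p) (map input a) q × Represents q κ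
  context⁺ {a = a} r (remove y t∈) =
    let p′ , u , r′ = runs-sync r refl t∈
    in _ , subst (λ b → Derivable _ _ b (context p′)) (cong (map input) (decode∘encode a))
             -- Only tests lie below anything in `≺`, so nothing outranks a communication.
             (ρ (∂ (θ u λ _ ()) λ ())) , running r′
  context⁺ r (absent {d = d} x t∈ d∉x) =
    let _ , u , r′ = runs-fire r t∈ in _ , ρ (∂ (θ u higher) λ ()) , running r′
    where
    higher : ∀ b → just (basic (inj₂ (_ , d))) ≺ b → ¬ (∃[ q ] _ —[ b ]→ q)
    higher _ test≺receive (_ , w) with runs⁻ r (rules⁻ w)
    -- A competing receive at port `d` would need a copy of `d` in `x`.
    ... | receive refl _ = ∈-⁅⁆∪ d _ d∉x
    higher _ test≺τ (_ , w) with () ← runs⁻ r (rules⁻ w)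

  represents⁻ : ∀ {p κ b q} → Represents p κ → p —[ b ]→ q →
                ∃[ κ′ ] (∃[ a ] b ≡ map input a × Step κ a κ′) × Represents q κ′
  represents⁻ (running r) u = context⁻ r (rules⁻ u)
  represents⁻ root u with rules⁻ u
  -- The defining equation puts the body itself, not its identifier, inside the context; `unfolded`
  -- covers this.
  ... | var w = context⁻ (unfolded initial) w

  represents⁺ : ∀ {p κ a κ′} → Represents p κ → Step κ a κ′ →
                ∃[ q ] p —[ map input a ]→ q × Represents q κ′
  represents⁺ (running r) st = let _ , u , e = context⁺ r st in _ , rules⁺ u , e
  represents⁺ root        st =
    let _ , u , e = context⁺ (unfolded initial) st in _ , rules⁺ (var u) , e

  -- The bisimulation between the two graphs

  M-graph : ProcessGraph BCPAct
  M-graph = embed input (PPDA.graph M)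

  Related : Rel (P ⊎ Config) 0ℓ
  Related (inj₁ p) (inj₂ κ) = Represents p κ
  Related (inj₂ κ) (inj₁ p) = Represents p κ
  Related _        _        = ⊥

  bisimilar : DPBranchingBisimilar Γ-graph M-graph
  bisimilar = strong⇒bisimilar union Related
    (λ {u} {w} → symmetric {u} {w}) (λ {u} {w} → step {u} {w}) (λ {u} {w} → accept {u} {w})
    {inj₁ (var zero)} {inj₂ (initial , ∅)} root
    where
    union : LTS BCPAct
    union = disjointUnion (ProcessGraph.lts Γ-graph) (ProcessGraph.lts M-graph)

    module U = LTS union

    symmetric : Symmetric Related
    symmetric {inj₁ p} {inj₂ κ} e = e
    symmetric {inj₂ κ} {inj₁ p} e = e

    step : ∀ {u w a u′} → Related u w → u U.—[ a ]→ u′ → ∃[ w′ ] w U.—[ a ]→ w′ × Related u′ w′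
    step {inj₁ p} {inj₂ κ} e (left v) =
      let κ′ , st , e′ = represents⁻ e v in inj₂ κ′ , right st , e′
    step {inj₂ κ} {inj₁ p} e (right (a , refl , st)) =
      let q , v , e′ = represents⁺ e st in inj₁ q , left v , e′

    accept : ∀ {u w} → Related u w → U.Accepting u → U.Accepting w
    accept {inj₁ p} {inj₂ κ} e (left a)  = right (represents-↓⁻ e a)
    accept {inj₂ κ} {inj₁ p} e (right a) = left (represents-↓⁺ e a)

theorem12 : (M : PPDA) →
    Σ[ S ∈ Signature ]
    Σ[ ι ∈ (PPDA.Input M ↣ Signature.Act S) ]
    Σ[ Γ ∈ BCP.Spec S ]
    (BCP.WeaklyGuarded S Γ ×
    DPBranchingBisimilar
    (BCP.Semantics.graph S Γ)
    (embed (Injection.to ι) (PPDA.graph M)))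
theorem12 M = signature , inputs , Γ , guarded , bisimilar
  where open Construction M
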